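{- For every $i\ge1$, the tree $\mathfrak S_{\omega^i}$ is tree-automatic. Moreover, there is a unary tree-automatic copy $(L,\le)$ of $\mathfrak S_{\omega^i}$ together with a computable isomorphism $f:\mathfrak S_{\omega^i}\to(L,\le)$.
   Context: Fundamental sequences: every limit ordinal $\alpha<\omega^\omega$ has Cantor normal form $\alpha=\omega^{e_j}n_j+\dots+\omega^{e_1}n_1$ with $e_j>\dots>e_1>0$ and $n_l>0$; set $\alpha_k=\omega^{e_j}n_j+\dots+\omega^{e_2}n_2+\omega^{e_1}(n_1-1)+\omega^{e_1-1}k+1$ for $k\ge1$. Trees $\mathfrak S_\alpha\subseteq\mathbb N_{>0}^*$ for $\alpha<\omega^\omega$ (ordered by the inverse prefix order, root $\varepsilon$): $\mathfrak S_0=\{\varepsilon\}$; $\mathfrak S_{\beta+1}=\{\varepsilon\}\cup\{mu\mid m\in\mathbb N_{>0},u\in\mathfrak S_\beta\}$; for limit $\alpha$, $\mathfrak S_\alpha=\{\varepsilon\}\cup\{ku\mid k\in\mathbb N_{>0},u\in\mathfrak S_{\alpha_k}\}$. A unary tree-automatic structure is one whose domain is a regular set of finite unlabeled binary trees (nonempty finite prefix-closed subsets of $\{0,1\}^*$) and whose relations have regular convolution sets (recognized by finite tree automata); tree-automatic means this over some finite label alphabet. -}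

module Defs where

open import Data.Nat using (ℕ; zero; suc; _≥_)
open import Data.Fin using (Fin)
open import Data.Bool using (Bool; true)
open import Data.Maybe using (Maybe; just; nothing; map)
open import Data.List using (List; []; _∷_; replicate; _++_; [_])
open import Data.List.Relation.Binary.Prefix.Heterogeneous using (Prefix)
open import Data.Product using (Σ; _×_; _,_; ∃-syntax)
open import Data.Unit using (⊤)
open import Relation.Binary.PropositionalEquality using (_≡_)
open import Function.Bundles using (_⇔_)

-- Ordinals below ω^ω, as Cantor-normal-form coefficient lists:
-- the list  c₀ ∷ c₁ ∷ … ∷ cₘ ∷ []  denotes  ω^m·cₘ + … + ω^1·c₁ + c₀.
-- (Trailing zeros are allowed and harmless.)

Ord : Set
Ord = List ℕ

ω^ : ℕ → Ord
ω^ i = replicate i 0 ++ [ 1 ]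

-- Auxiliary for fundamental sequences.  Given the coefficient list
-- starting at some exponent e ≥ 1, find the least exponent e₁ ≥ e with
-- nonzero coefficient n₁, replace it by n₁ - 1 and put k at exponent
-- e₁ - 1; the result is a coefficient list starting at exponent e - 1.
-- Returns nothing if all coefficients are zero.
fundAux : ℕ → List ℕ → Maybe (List ℕ)
fundAux k []           = nothing
fundAux k (suc n ∷ cs) = just (k ∷ n ∷ cs)
fundAux k (zero ∷ cs)  = map (0 ∷_) (fundAux k cs)

incHead : List ℕ → List ℕ
incHead []       = [ 1 ]
incHead (c ∷ cs) = suc c ∷ cs

-- For a limit ordinal α = 0 ∷ rest (i.e. with c₀ = 0 and some nonzero
-- coefficient), α_k is  incHead β  where  fundAux k rest ≡ just β , i.e.
-- α_k = ω^{e_j} n_j + … + ω^{e_1}(n_1 - 1) + ω^{e_1 - 1} k + 1.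

data _∈𝔖_ : List ℕ → Ord → Set where
  root    : ∀ α → [] ∈𝔖 α
  sucStep : ∀ c cs m u → m ≥ 1 → u ∈𝔖 (c ∷ cs) → (m ∷ u) ∈𝔖 (suc c ∷ cs)
  limStep : ∀ rest k β u → k ≥ 1 → fundAux k rest ≡ just β →
            u ∈𝔖 incHead β → (k ∷ u) ∈𝔖 (zero ∷ rest)

_≤𝔖_ : List ℕ → List ℕ → Set
u ≤𝔖 v = Prefix _≡_ v u

-- Finite binary trees labelled over Σ: a node with optional left (0) and
-- right (1) children.  This is exactly a nonempty finite prefix-closed
-- subset of {0,1}^* with a labelling.

data Tree (Σ : Set) : Set where
  node : Σ → Maybe (Tree Σ) → Maybe (Tree Σ) → Tree Σ

convM : ∀ {Σ} → Maybe (Tree Σ) → Maybe (Tree Σ) → Maybe (Tree (Maybe Σ × Maybe Σ))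
convM nothing nothing = nothing
convM (just (node a l r)) nothing =
  just (node (just a , nothing) (convM l nothing) (convM r nothing))
convM nothing (just (node b l r)) =
  just (node (nothing , just b) (convM nothing l) (convM nothing r))
convM (just (node a l r)) (just (node b l' r')) =
  just (node (just a , just b) (convM l l') (convM r r'))

conv : ∀ {Σ} → Tree Σ → Tree Σ → Tree (Maybe Σ × Maybe Σ)
conv (node a l r) (node b l' r') =
  node (just a , just b) (convM l l') (convM r r')

record TreeAutomaton (Γ : Set) : Set where
  field
    nStates : ℕ
    δ       : Γ → Maybe (Fin nStates) → Maybe (Fin nStates) → Fin nStates → Bool
    final   : Fin nStates → Bool

module _ {Γ : Set} (A : TreeAutomaton Γ) where
  open TreeAutomaton A

  mutual
    data Run : Tree Γ → Fin nStates → Set where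
      run : ∀ a l r ql qr q → RunM l ql → RunM r qr → δ a ql qr q ≡ true →
            Run (node a l r) q

    data RunM : Maybe (Tree Γ) → Maybe (Fin nStates) → Set where
      none : RunM nothing nothing
      some : ∀ {t q} → Run t q → RunM (just t) (just q)

  Accepts : Tree Γ → Set
  Accepts t = Σ (Fin nStates) λ q → Run t q × final q ≡ true

Regular : ∀ {Γ} → (Tree Γ → Set) → Set
Regular {Γ} P = Σ (TreeAutomaton Γ) λ A → ∀ t → P t ⇔ Accepts A t

-- A tree-automatic copy, with labels in Σ, of the structure (𝔖_α , ≤𝔖):
-- a regular domain L, a relation ≤ whose convolution set is regular,
-- and an isomorphism f : 𝔖_α → (L , ≤)  (given as an Agda function on
-- words, hence computable).

record TreeAutoCopy (Σ : Set) (α : Ord) : Set₁ where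
  field
    L       : Tree Σ → Set
    _≤L_    : Tree Σ → Tree Σ → Set
    L-reg   : Regular L
    ≤-reg   : Regular (λ x → ∃[ t ] ∃[ t' ] (L t × L t' × t ≤L t' × x ≡ conv t t'))
    f       : List ℕ → Tree Σ
    f-into  : ∀ u → u ∈𝔖 α → L (f u)
    f-inj   : ∀ u v → u ∈𝔖 α → v ∈𝔖 α → f u ≡ f v → u ≡ v
    f-onto  : ∀ t → L t → ∃[ u ] (u ∈𝔖 α × f u ≡ t)
    f-mono  : ∀ u v → u ∈𝔖 α → v ∈𝔖 α → (u ≤𝔖 v ⇔ f u ≤L f v)

TreeAutomatic : Ord → Set₁
TreeAutomatic α = Σ ℕ λ s → TreeAutoCopy (Fin s) α

UnaryTreeAutoCopy : Ord → Set₁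
UnaryTreeAutoCopy α = TreeAutoCopy ⊤ α

-- Reading a node u of 𝔖_α letter by letter only rewrites the Cantor normal form of α: a letter
-- read by a summand 1 deletes it, a letter k read by a summand ω^(L+1) replaces it by ω^L·k + 1,
-- the last summand being read first. So a node of 𝔖_{ω^i} splits into pieces read by successive
-- summands, and we encode it by a binary tree: a letter m read by 1 becomes a left chain of m nodes,
-- a letter k read by ω^(L+1) a left spine of k+1 nodes whose right subtrees encode the pieces read
-- by 1, ω^L, …, ω^L.
-- The pieces are full (leaves of their summand), then at most one is partial, then the rest are
-- absent; an automaton whose states record the exponent (at most i) and this status recognises
-- the encodings. Prefixes of nodes correspond exactly to deleting right subtrees, and as this keeps
-- the left structure, a synchronous automaton on the convolution checks it.

module Submission where

open import Data.Bool using (Bool; true; false; _∧_)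
open import Data.Empty using (⊥; ⊥-elim)
open import Data.Fin using (Fin)
import Data.Fin as Fin
open import Data.List
  using (List; []; _∷_; replicate; _++_; [_]; length; lookup; upTo; cartesianProductWith; cartesianProduct)
import Data.List as List
open import Data.List.Properties using (++-assoc; ++-identityʳ; ++-conicalˡ; length-++; length-replicate)
open import Data.List.Membership.Propositional using (_∈_)
open import Data.List.Membership.Propositional.Properties
  using (∈-++⁺ˡ; ∈-++⁺ʳ; ∈-map⁺; ∈-upTo⁺; ∈-cartesianProductWith⁺; ∈-cartesianProduct⁺)
open import Data.List.Relation.Binary.Pointwise using (Pointwise; []; _∷_; Pointwise-≡⇒≡; Pointwise-length)
import Data.List.Relation.Binary.Pointwise as Pointwise
open import Data.List.Relation.Binary.Prefix.Heterogeneous using (Prefix; []; _∷_; _++ᵖ_)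
import Data.List.Relation.Binary.Prefix.Heterogeneous.Properties as Prefix
open import Data.List.Relation.Unary.Any using (index; here; there)
open import Data.List.Relation.Unary.Any.Properties using (lookup-index)
open import Data.Maybe using (Maybe; just; nothing)
import Data.Maybe as Maybe
open import Data.Nat using (ℕ; zero; suc; pred; _≥_; _≤_; _<_; _+_; _<?_; s≤s; z≤n)
open import Data.Nat.Properties
  using (_≟_; <⇒≤; +-identityʳ; +-suc; suc-injective; ≤-refl; ≤-trans; m≤m+n; m≤n+m)
open import Data.Product using (Σ; _×_; _,_; ∃-syntax; proj₁; proj₂)
open import Data.Sum using (_⊎_; inj₁; inj₂)
open import Data.Unit using (tt)
open import Function.Base using (_∘_)
open import Function.Bundles using (_⇔_; mk⇔; Equivalence)
import Function.Properties.Equivalence as ⇔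
open import Relation.Binary.PropositionalEquality
  using (_≡_; refl; sym; trans; cong; cong₂; subst; subst₂; module ≡-Reasoning)
open import Relation.Nullary using (Dec; yes; no; does)
open import Relation.Nullary.Decidable using (dec-true; _×-dec_)

open import Defs

-- Node ls u : u is a node of 𝔖_α, where α is the sum of the ω^e for e in ls, listed from the
-- smallest summand, which reads the next letter.
data Node : List ℕ → List ℕ → Set where
  ε    : ∀ ls → Node ls []
  succ : ∀ {m ls u} → m ≥ 1 → Node ls u → Node (0 ∷ ls) (m ∷ u)
  lim  : ∀ {L ls k u} → k ≥ 1 → Node (0 ∷ replicate k L ++ ls) u → Node (suc L ∷ ls) (k ∷ u)

data Leaf : List ℕ → List ℕ → Set where
  ε    : Leaf [] []
  succ : ∀ {m ls u} → m ≥ 1 → Leaf ls u → Leaf (0 ∷ ls) (m ∷ u)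
  lim  : ∀ {L ls k u} → k ≥ 1 → Leaf (0 ∷ replicate k L ++ ls) u → Leaf (suc L ∷ ls) (k ∷ u)

private
  ++-assoc-lim : ∀ k L (as bs : List ℕ) →
                 (0 ∷ replicate k L ++ as) ++ bs ≡ 0 ∷ replicate k L ++ (as ++ bs)
  ++-assoc-lim k L as bs = cong (0 ∷_) (++-assoc (replicate k L) as bs)

Node-++ʳ : ∀ {as u} bs → Node as u → Node (as ++ bs) u
Node-++ʳ bs (ε _) = ε _
Node-++ʳ bs (succ m p) = succ m (Node-++ʳ bs p)
Node-++ʳ {suc L ∷ as} {k ∷ u} bs (lim h p) =
  lim h (subst (λ ls → Node ls u) (++-assoc-lim k L as bs) (Node-++ʳ bs p))

Leaf-++-Node : ∀ {as bs c w} → Leaf as c → Node bs w → Node (as ++ bs) (c ++ w)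
Leaf-++-Node ε q = q
Leaf-++-Node (succ m p) q = succ m (Leaf-++-Node p q)
Leaf-++-Node {suc L ∷ as} {bs} {k ∷ c} {w} (lim h p) q =
  lim h (subst (λ ls → Node ls (c ++ w)) (++-assoc-lim k L as bs) (Leaf-++-Node p q))

Leaf-++ : ∀ {as bs c w} → Leaf as c → Leaf bs w → Leaf (as ++ bs) (c ++ w)
Leaf-++ ε q = q
Leaf-++ (succ m p) q = succ m (Leaf-++ p q)
Leaf-++ {suc L ∷ as} {bs} {k ∷ c} {w} (lim h p) q =
  lim h (subst (λ ls → Leaf ls (c ++ w)) (++-assoc-lim k L as bs) (Leaf-++ p q))

Node-++⁻ : ∀ as {bs} u → Node (as ++ bs) u →
           Node as u ⊎ ∃[ c ] ∃[ w ] (u ≡ c ++ w × Leaf as c × Node bs w)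
Node-++⁻ [] u p = inj₂ ([] , u , refl , ε , p)
Node-++⁻ (a ∷ as) [] p = inj₁ (ε _)
Node-++⁻ (zero ∷ as) (m ∷ u) (succ h p) with Node-++⁻ as u p
... | inj₁ q = inj₁ (succ h q)
... | inj₂ (c , w , refl , lc , nw) = inj₂ (m ∷ c , w , refl , succ h lc , nw)
Node-++⁻ (suc L ∷ as) {bs} (k ∷ u) (lim h p)
  with Node-++⁻ (0 ∷ replicate k L ++ as) u (subst (λ ls → Node ls u) (sym (++-assoc-lim k L as bs)) p)
... | inj₁ q = inj₁ (lim h q)
... | inj₂ (c , w , refl , lc , nw) = inj₂ (k ∷ c , w , refl , lim h lc , nw)

Leaf-++⁻ : ∀ as {bs} u → Leaf (as ++ bs) u → ∃[ c ] ∃[ w ] (u ≡ c ++ w × Leaf as c × Leaf bs w)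
Leaf-++⁻ [] u p = [] , u , refl , ε , p
Leaf-++⁻ (zero ∷ as) (m ∷ u) (succ h p) with Leaf-++⁻ as u p
... | (c , w , refl , lc , lw) = m ∷ c , w , refl , succ h lc , lw
Leaf-++⁻ (suc L ∷ as) {bs} (k ∷ u) (lim h p)
  with Leaf-++⁻ (0 ∷ replicate k L ++ as) u (subst (λ ls → Leaf ls u) (sym (++-assoc-lim k L as bs)) p)
... | (c , w , refl , lc , lw) = k ∷ c , w , refl , lim h lc , lw

Leaf-maximal : ∀ {ls c x y} → Leaf ls c → Node ls (c ++ x ∷ y) → ⊥
Leaf-maximal ε ()
Leaf-maximal (succ _ p) (succ _ q) = Leaf-maximal p q
Leaf-maximal (lim _ p) (lim _ q) = Leaf-maximal p q

exponentsFrom : ℕ → Ord → List ℕ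
exponentsFrom e [] = []
exponentsFrom e (c ∷ cs) = replicate c e ++ exponentsFrom (suc e) cs

exponents : Ord → List ℕ
exponents = exponentsFrom 0

exponents-incHead : ∀ β → exponents (incHead β) ≡ 0 ∷ exponents β
exponents-incHead [] = refl
exponents-incHead (b ∷ bs) = refl

fundAux-exponents : ∀ k e cs {β} → fundAux k cs ≡ just β →
  ∃[ e' ] ∃[ X ] (exponentsFrom (suc e) cs ≡ suc e' ∷ X × exponentsFrom e β ≡ replicate k e' ++ X)
fundAux-exponents k e (suc n ∷ cs) refl = e , _ , refl , refl
fundAux-exponents k e (zero ∷ cs) eq with fundAux k cs in eq'
fundAux-exponents k e (zero ∷ cs) refl | just β = fundAux-exponents k (suc e) cs eq'

exponents-fundAux : ∀ k e cs {e' X} → exponentsFrom (suc e) cs ≡ suc e' ∷ X →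
  ∃[ β ] (fundAux k cs ≡ just β × exponentsFrom e β ≡ replicate k e' ++ X)
exponents-fundAux k e (suc n ∷ cs) refl = _ , refl , refl
exponents-fundAux k e (zero ∷ cs) eq with exponents-fundAux k (suc e) cs eq
... | β , eqβ , exps rewrite eqβ = 0 ∷ β , refl , exps

exponentsFrom-suc≢0∷ : ∀ e cs {X} → exponentsFrom (suc e) cs ≡ 0 ∷ X → ⊥
exponentsFrom-suc≢0∷ e (suc n ∷ cs) ()
exponentsFrom-suc≢0∷ e (zero ∷ cs) eq = exponentsFrom-suc≢0∷ (suc e) cs eq

∈𝔖⇒Node : ∀ {u α} → u ∈𝔖 α → Node (exponents α) u
∈𝔖⇒Node (root α) = ε _
∈𝔖⇒Node (sucStep c cs m u h p) = succ h (∈𝔖⇒Node p)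
∈𝔖⇒Node (limStep rest k β u h eq p) with fundAux-exponents k 0 rest eq
... | e' , X , exps , exps-β rewrite exps =
  lim h (subst (λ ls → Node ls u) (trans (exponents-incHead β) (cong (0 ∷_) exps-β)) (∈𝔖⇒Node p))

Node⇒∈𝔖 : ∀ α u → Node (exponents α) u → u ∈𝔖 α
Node⇒∈𝔖 α [] _ = root α
Node⇒∈𝔖 (suc c ∷ cs) (m ∷ u) (succ h p) = sucStep c cs m u h (Node⇒∈𝔖 (c ∷ cs) u p)
Node⇒∈𝔖 (zero ∷ rest) (k ∷ u) p with exponentsFrom 1 rest in exps | p
... | zero ∷ X | succ _ _ = ⊥-elim (exponentsFrom-suc≢0∷ 0 rest exps)
... | suc e' ∷ X | lim h q with exponents-fundAux k 0 rest exps
... | β , eq , exps-β = limStep rest k β u h eq (Node⇒∈𝔖 (incHead β) u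
        (subst (λ ls → Node ls u) (sym (trans (exponents-incHead β) (cong (0 ∷_) exps-β))) q))

exponentsFrom-ω^ : ∀ i e → exponentsFrom e (ω^ i) ≡ [ i + e ]
exponentsFrom-ω^ zero e = refl
exponentsFrom-ω^ (suc i) e = trans (exponentsFrom-ω^ i (suc e)) (cong [_] (+-suc i e))

exponents-ω^ : ∀ i → exponents (ω^ i) ≡ [ i ]
exponents-ω^ i = trans (exponentsFrom-ω^ i 0) (cong [_] (+-identityʳ i))

∈𝔖ω^⇔Node : ∀ i {u} → u ∈𝔖 ω^ i ⇔ Node [ i ] u
∈𝔖ω^⇔Node i {u} = mk⇔
  (λ p → subst (λ ls → Node ls u) (exponents-ω^ i) (∈𝔖⇒Node p))
  (λ p → Node⇒∈𝔖 (ω^ i) u (subst (λ ls → Node ls u) (sym (exponents-ω^ i)) p))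

module _ {A : Set} where

  Prefix-++⁻ : ∀ {v : List A} c {w} → Prefix _≡_ v (c ++ w) →
               Prefix _≡_ v c ⊎ ∃[ v' ] (v ≡ c ++ v' × Prefix _≡_ v' w)
  Prefix-++⁻ [] p = inj₂ (_ , refl , p)
  Prefix-++⁻ (x ∷ c) [] = inj₁ []
  Prefix-++⁻ (x ∷ c) (refl ∷ p) with Prefix-++⁻ c p
  ... | inj₁ q = inj₁ (refl ∷ q)
  ... | inj₂ (v' , refl , q) = inj₂ (v' , refl , q)

  Prefix-≡⇒++ : ∀ {xs ys : List A} → Prefix _≡_ xs ys → ∃[ d ] ys ≡ xs ++ d
  Prefix-≡⇒++ {ys = ys} [] = ys , refl
  Prefix-≡⇒++ (refl ∷ p) with Prefix-≡⇒++ p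
  ... | d , refl = d , refl

  Prefix-refl : ∀ {xs : List A} → Prefix _≡_ xs xs
  Prefix-refl = Prefix.fromPointwise (Pointwise.refl refl)

  Prefix-++ˡ : ∀ (zs : List A) {xs ys} → Prefix _≡_ xs ys → Prefix _≡_ (zs ++ xs) (zs ++ ys)
  Prefix-++ˡ zs = Prefix.++⁺ (Pointwise.refl refl)

  Prefix-antisym : ∀ {xs ys : List A} → Prefix _≡_ xs ys → Prefix _≡_ ys xs → xs ≡ ys
  Prefix-antisym p q = Pointwise-≡⇒≡ (Prefix.antisym (λ x≡y _ → x≡y) p q)

Leaf-Prefix-Node : ∀ {ls c' c} → Leaf ls c' → Node ls c → Prefix _≡_ c' c → c ≡ c'
Leaf-Prefix-Node {c' = c'} lf nd p with Prefix-≡⇒++ p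
... | [] , refl = ++-identityʳ c'
... | x ∷ d , refl = ⊥-elim (Leaf-maximal lf nd)

absents : ∀ {A : Set} → ℕ → List (Maybe A)
absents n = replicate n nothing

module _ {Lab : Set} where

  mutual
    data _⊒_ : Tree Lab → Tree Lab → Set where
      ⊒-node : ∀ {x y l r l' r'} → l ⊒ˡ l' → r ⊒ʳ r' → node x l r ⊒ node y l' r'

    data _⊒ˡ_ : Maybe (Tree Lab) → Maybe (Tree Lab) → Set where
      ⊒ˡ-nothing : nothing ⊒ˡ nothing
      ⊒ˡ-just    : ∀ {t t'} → t ⊒ t' → just t ⊒ˡ just t'

    data _⊒ʳ_ : Maybe (Tree Lab) → Maybe (Tree Lab) → Set where
      ⊒ʳ-cut  : ∀ {m} → m ⊒ʳ nothing
      ⊒ʳ-just : ∀ {t t'} → t ⊒ t' → just t ⊒ʳ just t'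

  mutual
    ⊒-refl : ∀ t → t ⊒ t
    ⊒-refl (node x l r) = ⊒-node (⊒ˡ-refl l) (⊒ʳ-refl r)

    ⊒ˡ-refl : ∀ m → m ⊒ˡ m
    ⊒ˡ-refl nothing = ⊒ˡ-nothing
    ⊒ˡ-refl (just t) = ⊒ˡ-just (⊒-refl t)

    ⊒ʳ-refl : ∀ m → m ⊒ʳ m
    ⊒ʳ-refl nothing = ⊒ʳ-cut
    ⊒ʳ-refl (just t) = ⊒ʳ-just (⊒-refl t)

  ⊒ʳ-absents : ∀ ss → Pointwise _⊒ʳ_ ss (absents (length ss))
  ⊒ʳ-absents [] = []
  ⊒ʳ-absents (s ∷ ss) = ⊒ʳ-cut ∷ ⊒ʳ-absents ss

  absents-⊒ʳ : ∀ {n ss'} → Pointwise _⊒ʳ_ (absents n) ss' → ss' ≡ absents n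
  absents-⊒ʳ {zero} [] = refl
  absents-⊒ʳ {suc n} (⊒ʳ-cut ∷ ms) = cong (nothing ∷_) (absents-⊒ʳ ms)

-- The status of a word read by a summand: nothing read, a proper part read, or a leaf reached.
data Fill : Set where
  empty partial full : Fill

nonempty : Fill → Fill
nonempty empty = partial
nonempty partial = partial
nonempty full = full

nonempty-full : ∀ {s} → nonempty s ≡ full → s ≡ full
nonempty-full {full} refl = refl

-- Cons f₀ f₁ f mirrors the constructors absent∷, partial∷ and full∷ of Encs.
data Cons : Fill → Fill → Fill → Set where
  empty-empty   : Cons empty empty empty
  partial-empty : Cons partial empty partial
  full-any      : ∀ {f} → Cons full f (nonempty f)

data Ends : Fill → Set where
  ends-empty : Ends empty
  ends-full  : Ends full

module Encoding {Lab : Set} (a : Lab) where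

  leftChain : ℕ → Tree Lab
  leftChain zero = node a nothing nothing
  leftChain (suc n) = node a (just (leftChain n)) nothing

  leftSpine : Maybe (Tree Lab) → List (Maybe (Tree Lab)) → Tree Lab
  leftSpine s [] = node a nothing s
  leftSpine s (s' ∷ ss) = node a (just (leftSpine s' ss)) s

  -- encode l u encodes the longest prefix of u consumed by a summand ω^l and returns the rest of u.
  mutual
    encode : ℕ → List ℕ → Maybe (Tree Lab) × List ℕ
    encode l [] = nothing , []
    encode zero (m ∷ u) = just (leftChain (pred m)) , u
    encode (suc L) (k ∷ u) =
      just (leftSpine (proj₁ (encode 0 u)) (proj₁ (encodeMany k L (proj₂ (encode 0 u))))) ,
      proj₂ (encodeMany k L (proj₂ (encode 0 u)))

    encodeMany : ℕ → ℕ → List ℕ → List (Maybe (Tree Lab)) × List ℕ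
    encodeMany zero L u = [] , u
    encodeMany (suc k) L u =
      (proj₁ (encode L u) ∷ proj₁ (encodeMany k L (proj₂ (encode L u)))) ,
      proj₂ (encodeMany k L (proj₂ (encode L u)))

  -- Encs ls w ss f : w is split among the summands ls into full pieces, then at most one partial
  -- piece, then empty ones; ss lists the encodings of the pieces.
  mutual
    data Enc : ℕ → List ℕ → Maybe (Tree Lab) → Fill → Set where
      absent : ∀ {l} → Enc l [] nothing empty
      chain  : ∀ n → Enc 0 (suc n ∷ []) (just (leftChain n)) full
      spine  : ∀ {L k w s ss f} → Encs (0 ∷ replicate (suc k) L) w (s ∷ ss) f →
               Enc (suc L) (suc k ∷ w) (just (leftSpine s ss)) (nonempty f)

    data Encs : List ℕ → List ℕ → List (Maybe (Tree Lab)) → Fill → Set where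
      []-empty : Encs [] [] [] empty
      []-full  : Encs [] [] [] full
      absent∷  : ∀ {l ls ss} → Encs ls [] ss empty → Encs (l ∷ ls) [] (nothing ∷ ss) empty
      partial∷ : ∀ {l ls c s ss} → Enc l c s partial → Encs ls [] ss empty →
                 Encs (l ∷ ls) c (s ∷ ss) partial
      full∷    : ∀ {l ls c s w ss f} → Enc l c s full → Encs ls w ss f →
                 Encs (l ∷ ls) (c ++ w) (s ∷ ss) (nonempty f)

  mutual
    Enc⇒Leaf : ∀ {l u s f} → Enc l u s f → f ≡ full → Leaf [ l ] u
    Enc⇒Leaf (chain n) _ = succ (s≤s z≤n) ε
    Enc⇒Leaf (spine {L} {k} {w} p) f≡full = lim (s≤s z≤n)
      (subst (λ ls → Leaf ls w) (sym (++-identityʳ (0 ∷ replicate (suc k) L)))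
             (Encs⇒Leaf p (nonempty-full f≡full)))

    Encs⇒Leaf : ∀ {ls w ss f} → Encs ls w ss f → f ≡ full → Leaf ls w
    Encs⇒Leaf []-full _ = ε
    Encs⇒Leaf (full∷ c p) f≡full = Leaf-++ (Enc⇒Leaf c refl) (Encs⇒Leaf p (nonempty-full f≡full))

  mutual
    Enc⇒Node : ∀ {l u s f} → Enc l u s f → Node [ l ] u
    Enc⇒Node absent = ε _
    Enc⇒Node (chain n) = succ (s≤s z≤n) (ε _)
    Enc⇒Node (spine p) = lim (s≤s z≤n) (Node-++ʳ [] (Encs⇒Node p))

    Encs⇒Node : ∀ {ls w ss f} → Encs ls w ss f → Node ls w
    Encs⇒Node []-empty = ε _
    Encs⇒Node []-full = ε _
    Encs⇒Node (absent∷ p) = ε _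
    Encs⇒Node (partial∷ {ls = ls} c p) = Node-++ʳ ls (Enc⇒Node c)
    Encs⇒Node (full∷ c p) = Leaf-++-Node (Enc⇒Leaf c refl) (Encs⇒Node p)

  Encs-absent : ∀ ls → Encs ls [] (absents (length ls)) empty
  Encs-absent [] = []-empty
  Encs-absent (l ∷ ls) = absent∷ (Encs-absent ls)

  Enc-[] : ∀ {l s f} → Enc l [] s f → s ≡ nothing × f ≡ empty
  Enc-[] absent = refl , refl

  Enc-nothing : ∀ {l c f} → Enc l c nothing f → c ≡ [] × f ≡ empty
  Enc-nothing absent = refl , refl

  Enc-empty : ∀ {l c s f} → Enc l c s f → f ≡ empty → c ≡ [] × s ≡ nothing
  Enc-empty absent _ = refl , refl
  Enc-empty (spine {f = empty} p) ()
  Enc-empty (spine {f = partial} p) ()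
  Enc-empty (spine {f = full} p) ()

  Encs-[] : ∀ {ls w ss f} → Encs ls w ss f → w ≡ [] → ss ≡ absents (length ls)
  Encs-[] []-empty _ = refl
  Encs-[] []-full _ = refl
  Encs-[] (absent∷ p) _ = cong (nothing ∷_) (Encs-[] p refl)
  Encs-[] (partial∷ c p) refl with () ← proj₂ (Enc-[] c)
  Encs-[] (full∷ {c = c} {w = w} e p) c++w≡[] with ++-conicalˡ c w c++w≡[]
  ... | refl with () ← proj₂ (Enc-[] e)

  Encs-absents : ∀ {ls w f} → Encs ls w (absents (length ls)) f → w ≡ []
  Encs-absents {[]} []-empty = refl
  Encs-absents {[]} []-full = refl
  Encs-absents {l ∷ ls} (absent∷ p) = refl
  Encs-absents {l ∷ ls} (partial∷ c p) with () ← proj₂ (Enc-nothing c)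
  Encs-absents {l ∷ ls} (full∷ c p) with () ← proj₂ (Enc-nothing c)

  Encs-length : ∀ {ls w ss f} → Encs ls w ss f → length ss ≡ length ls
  Encs-length []-empty = refl
  Encs-length []-full = refl
  Encs-length (absent∷ p) = cong suc (Encs-length p)
  Encs-length (partial∷ c p) = cong suc (Encs-length p)
  Encs-length (full∷ c p) = cong suc (Encs-length p)

  full∷[] : ∀ {l ls c s ss f} → Enc l c s full → Encs ls [] ss f → Encs (l ∷ ls) c (s ∷ ss) (nonempty f)
  full∷[] {l} {ls} {c} {s} {ss} {f} e p =
    subst (λ w → Encs (l ∷ ls) w (s ∷ ss) (nonempty f)) (++-identityʳ c) (full∷ e p)

  Encs-single : ∀ {l ls v s f} → Enc l v s f → ∃[ f' ] Encs (l ∷ ls) v (s ∷ absents (length ls)) f'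
  Encs-single {ls = ls} absent = empty , absent∷ (Encs-absent ls)
  Encs-single {ls = ls} (chain n) = _ , full∷[] (chain n) (Encs-absent ls)
  Encs-single {ls = ls} (spine {f = empty} p) = partial , partial∷ (spine p) (Encs-absent ls)
  Encs-single {ls = ls} (spine {f = partial} p) = partial , partial∷ (spine p) (Encs-absent ls)
  Encs-single {ls = ls} (spine {f = full} p) = _ , full∷[] (spine p) (Encs-absent ls)

  private
    length-≤ˡ : ∀ {u} (c w : List ℕ) {n} → u ≡ c ++ w → length u ≤ n → length c ≤ n
    length-≤ˡ c w refl le = ≤-trans (subst (length c ≤_) (sym (length-++ c)) (m≤m+n _ _)) le

    length-≤ʳ : ∀ {u} (c w : List ℕ) {n} → u ≡ c ++ w → length u ≤ n → length w ≤ n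
    length-≤ʳ c w refl le = ≤-trans (subst (length w ≤_) (sym (length-++ c)) (m≤n+m _ _)) le

    Node-++[] : ∀ {ls u} → Node (ls ++ []) u → Node ls u
    Node-++[] {ls} {u} = subst (λ ls → Node ls u) (++-identityʳ ls)

    Leaf-++[] : ∀ {ls u} → Leaf (ls ++ []) u → Leaf ls u
    Leaf-++[] {ls} {u} = subst (λ ls → Leaf ls u) (++-identityʳ ls)

    -- The fuel n bounds the length of the word, which decreases under every spine.
    mutual
      Node⇒Enc≤ : ∀ n {l c} → length c ≤ n → Node [ l ] c → ∃[ s ] ∃[ f ] Enc l c s f
      Node⇒Enc≤ n {l} {[]} _ _ = nothing , empty , absent
      Node⇒Enc≤ n {zero} {suc m ∷ []} _ (succ _ (ε _)) = just (leftChain m) , full , chain m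
      Node⇒Enc≤ (suc n) {suc L} {suc k ∷ c} (s≤s le) (lim _ p)
        with Node⇒Encs≤ n (0 ∷ replicate (suc k) L) le (Node-++[] p)
      ... | s ∷ ss , f , e = just (leftSpine s ss) , nonempty f , spine e

      Node⇒Encs≤ : ∀ n ls {u} → length u ≤ n → Node ls u → ∃[ ss ] ∃[ f ] Encs ls u ss f
      Node⇒Encs≤ n ls {[]} _ _ = _ , empty , Encs-absent ls
      Node⇒Encs≤ n (l ∷ ls) {x ∷ u} le p with Node-++⁻ [ l ] (x ∷ u) p
      ... | inj₁ q with Node⇒Enc≤ n le q
      ...   | s , f , e = _ , Encs-single e
      Node⇒Encs≤ n (l ∷ ls) {x ∷ u} le p | inj₂ (c , w , eq , lc , nw)
        with Leaf⇒Enc≤ n (length-≤ˡ c w eq le) lc | Node⇒Encs≤ n ls (length-≤ʳ c w eq le) nw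
      ... | s , e | ss , f , es =
        s ∷ ss , nonempty f , subst (λ v → Encs (l ∷ ls) v (s ∷ ss) (nonempty f)) (sym eq) (full∷ e es)

      Leaf⇒Enc≤ : ∀ n {l c} → length c ≤ n → Leaf [ l ] c → ∃[ s ] Enc l c s full
      Leaf⇒Enc≤ n {zero} {suc m ∷ []} _ (succ _ ε) = just (leftChain m) , chain m
      Leaf⇒Enc≤ (suc n) {suc L} {suc k ∷ c} (s≤s le) (lim _ p)
        with Leaf⇒Encs≤ n (0 ∷ replicate (suc k) L) le (Leaf-++[] p)
      ... | s ∷ ss , e = just (leftSpine s ss) , spine e

      Leaf⇒Encs≤ : ∀ n ls {u} → length u ≤ n → Leaf ls u → ∃[ ss ] Encs ls u ss full
      Leaf⇒Encs≤ n [] {[]} _ ε = [] , []-full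
      Leaf⇒Encs≤ n (l ∷ ls) {u} le p with Leaf-++⁻ [ l ] u p
      ... | c , w , eq , lc , lw
        with Leaf⇒Enc≤ n (length-≤ˡ c w eq le) lc | Leaf⇒Encs≤ n ls (length-≤ʳ c w eq le) lw
      ... | s , e | ss , es = s ∷ ss , subst (λ v → Encs (l ∷ ls) v (s ∷ ss) full) (sym eq) (full∷ e es)

  Node⇒Enc : ∀ l {u} → Node [ l ] u → ∃[ s ] ∃[ f ] Enc l u s f
  Node⇒Enc l {u} = Node⇒Enc≤ (length u) ≤-refl

  -- Encoding u ++ r reproduces the encoding of u when the reading of u is complete or r is empty.
  Followable : Fill → List ℕ → Set
  Followable f r = f ≡ full ⊎ r ≡ []

  private
    Followable-nonempty : ∀ {f r} → Followable (nonempty f) r → Followable f r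
    Followable-nonempty (inj₁ e) = inj₁ (nonempty-full e)
    Followable-nonempty (inj₂ e) = inj₂ e

  mutual
    encode-Enc : ∀ {l w s f} → Enc l w s f → ∀ r → Followable f r → encode l (w ++ r) ≡ (s , r)
    encode-Enc absent .[] (inj₂ refl) = refl
    encode-Enc (chain n) r _ = refl
    encode-Enc (spine {L} {k} {w} {s} p) r fr with encode-Encs-head p r (Followable-nonempty fr)
    ... | w' , f' , p' , fr' , eq =
      trans (cong (λ e → just (leftSpine (proj₁ e) (proj₁ (encodeMany (suc k) L (proj₂ e)))) ,
                         proj₂ (encodeMany (suc k) L (proj₂ e))) eq)
            (cong (λ e → just (leftSpine s (proj₁ e)) , proj₂ e) (encodeMany-Encs (suc k) L p' r fr'))

    encode-Encs-head : ∀ {l ls w s ss f} → Encs (l ∷ ls) w (s ∷ ss) f → ∀ r → Followable f r →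
      ∃[ w' ] ∃[ f' ] (Encs ls w' ss f' × Followable f' r × encode l (w ++ r) ≡ (s , w' ++ r))
    encode-Encs-head (absent∷ p) .[] (inj₂ refl) = [] , empty , p , inj₂ refl , refl
    encode-Encs-head (partial∷ e p) .[] (inj₂ refl) = [] , empty , p , inj₂ refl , encode-Enc e [] (inj₂ refl)
    encode-Encs-head (full∷ {c = c} {w = w'} e p) r fr =
      w' , _ , p , Followable-nonempty fr ,
      trans (cong (encode _) (++-assoc c w' r)) (encode-Enc e (w' ++ r) (inj₁ refl))

    encodeMany-Encs : ∀ k L {w ss f} → Encs (replicate k L) w ss f → ∀ r → Followable f r →
                      encodeMany k L (w ++ r) ≡ (ss , r)
    encodeMany-Encs zero L []-empty .[] (inj₂ refl) = refl
    encodeMany-Encs zero L []-full r _ = refl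
    encodeMany-Encs (suc k) L {ss = s ∷ ss} p r fr with encode-Encs-head p r fr
    ... | w' , f' , p' , fr' , eq rewrite eq | encodeMany-Encs k L p' r fr' = refl

  Enc⇒encode : ∀ {l w s f} → Enc l w s f → encode l w ≡ (s , [])
  Enc⇒encode {l} {w} e = trans (cong (encode l) (sym (++-identityʳ w))) (encode-Enc e [] (inj₂ refl))

  Enc-functional : ∀ {l u s s' f f'} → Enc l u s f → Enc l u s' f' → s ≡ s'
  Enc-functional e e' = cong proj₁ (trans (sym (Enc⇒encode e)) (Enc⇒encode e'))

  Encs-empty : ∀ {ls w ss f} → Encs ls w ss f → f ≡ empty → w ≡ []
  Encs-empty []-empty _ = refl
  Encs-empty (absent∷ _) _ = refl
  Encs-empty (full∷ {f = empty} _ _) ()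
  Encs-empty (full∷ {f = partial} _ _) ()
  Encs-empty (full∷ {f = full} _ _) ()

  Encs-cons : ∀ {l ls w w₁ m ss f₀ f₁ f} → Enc l w m f₀ → Encs ls w₁ ss f₁ → Cons f₀ f₁ f →
              ∃[ w' ] Encs (l ∷ ls) w' (m ∷ ss) f
  Encs-cons e p empty-empty with refl , refl ← Enc-empty e refl | refl ← Encs-empty p refl = [] , absent∷ p
  Encs-cons e p partial-empty with refl ← Encs-empty p refl = _ , partial∷ e p
  Encs-cons e p full-any = _ , full∷ e p

  Ends⇒Encs-[] : ∀ {f} → Ends f → Encs [] [] [] f
  Ends⇒Encs-[] ends-empty = []-empty
  Ends⇒Encs-[] ends-full = []-full

  Encs-[]-Ends : ∀ {ls w f} → Encs ls w [] f → Ends f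
  Encs-[]-Ends []-empty = ends-empty
  Encs-[]-Ends []-full = ends-full

  leftSpine-⊒ : ∀ {s s' ss ss'} → Pointwise _⊒ʳ_ (s ∷ ss) (s' ∷ ss') → leftSpine s ss ⊒ leftSpine s' ss'
  leftSpine-⊒ (m ∷ []) = ⊒-node ⊒ˡ-nothing m
  leftSpine-⊒ (m ∷ (m' ∷ ms)) = ⊒-node (⊒ˡ-just (leftSpine-⊒ (m' ∷ ms))) m

  leftSpine-⊒⁻ : ∀ {s s'} ss ss' → leftSpine s ss ⊒ leftSpine s' ss' → Pointwise _⊒ʳ_ (s ∷ ss) (s' ∷ ss')
  leftSpine-⊒⁻ [] [] (⊒-node ⊒ˡ-nothing m) = m ∷ []
  leftSpine-⊒⁻ [] (_ ∷ _) (⊒-node () _)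
  leftSpine-⊒⁻ (_ ∷ _) [] (⊒-node () _)
  leftSpine-⊒⁻ (x ∷ ss) (y ∷ ss') (⊒-node (⊒ˡ-just t) m) = m ∷ leftSpine-⊒⁻ ss ss' t

  leftChain-⊒⁻ : ∀ n n' → leftChain n ⊒ leftChain n' → n ≡ n'
  leftChain-⊒⁻ zero zero _ = refl
  leftChain-⊒⁻ zero (suc n') (⊒-node () _)
  leftChain-⊒⁻ (suc n) zero (⊒-node () _)
  leftChain-⊒⁻ (suc n) (suc n') (⊒-node (⊒ˡ-just t) _) = cong suc (leftChain-⊒⁻ n n' t)

  Encs-⊒ʳ-absents : ∀ {ls w ss f} → Encs ls w ss f → Pointwise _⊒ʳ_ ss (absents (length ls))
  Encs-⊒ʳ-absents {ls} {ss = ss} p = subst (λ n → Pointwise _⊒ʳ_ ss (absents n)) (Encs-length p) (⊒ʳ-absents ss)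

  mutual
    Enc-Prefix : ∀ {l u s f v} → Enc l u s f → Prefix _≡_ v u →
                 ∃[ s' ] ∃[ f' ] (Enc l v s' f' × s ⊒ʳ s')
    Enc-Prefix {v = []} e _ = nothing , empty , absent , ⊒ʳ-cut
    Enc-Prefix {v = x ∷ v} (chain n) (refl ∷ []) = _ , full , chain n , ⊒ʳ-refl _
    Enc-Prefix {v = x ∷ v} (spine p) (refl ∷ pre) with Encs-Prefix p pre
    ... | s' ∷ ss' , f' , p' , ms = just (leftSpine s' ss') , nonempty f' , spine p' , ⊒ʳ-just (leftSpine-⊒ ms)

    Encs-Prefix : ∀ {ls w ss f v} → Encs ls w ss f → Prefix _≡_ v w →
                  ∃[ ss' ] ∃[ f' ] (Encs ls v ss' f' × Pointwise _⊒ʳ_ ss ss')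
    Encs-Prefix {ls} {v = []} p _ = absents (length ls) , empty , Encs-absent ls , Encs-⊒ʳ-absents p
    Encs-Prefix (partial∷ e p) pre = Encs-Prefix-head e p pre
    Encs-Prefix (full∷ {c = c} e p) pre with Prefix-++⁻ c pre
    ... | inj₁ q = Encs-Prefix-head e p q
    ... | inj₂ (v' , refl , q) with Encs-Prefix p q
    ...   | ss' , f' , p' , ms = _ ∷ ss' , nonempty f' , full∷ e p' , ⊒ʳ-refl _ ∷ ms

    Encs-Prefix-head : ∀ {l ls c s f w ss f' v} → Enc l c s f → Encs ls w ss f' → Prefix _≡_ v c →
                       ∃[ ss' ] ∃[ f' ] (Encs (l ∷ ls) v ss' f' × Pointwise _⊒ʳ_ (s ∷ ss) ss')
    Encs-Prefix-head e p pre with Enc-Prefix e pre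
    ... | s' , f' , e' , m with Encs-single e'
    ...   | f'' , es = _ , f'' , es , m ∷ Encs-⊒ʳ-absents p

  spine-arity-unique : ∀ {L k k' w w' ss ss' f f'} →
    Encs (0 ∷ replicate (suc k) L) w ss f → Encs (0 ∷ replicate (suc k') L) w' ss' f' →
    Pointwise _⊒ʳ_ ss ss' → k ≡ k'
  spine-arity-unique {L} {k} {k'} {ss = ss} {ss'} p p' ms = suc-injective (suc-injective (begin
    suc (suc k)                              ≡⟨ cong suc (sym (length-replicate (suc k))) ⟩
    length (0 ∷ replicate (suc k) L)         ≡⟨ sym (Encs-length p) ⟩
    length ss                                ≡⟨ Pointwise-length ms ⟩
    length ss'                               ≡⟨ Encs-length p' ⟩
    length (0 ∷ replicate (suc k') L)        ≡⟨ cong suc (length-replicate (suc k')) ⟩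
    suc (suc k')                             ∎))
    where open ≡-Reasoning

  mutual
    ⊒ʳ⇒Prefix : ∀ {l u v s s' f f'} → Enc l u s f → Enc l v s' f' → s ⊒ʳ s' → Prefix _≡_ v u
    ⊒ʳ⇒Prefix _ absent _ = []
    ⊒ʳ⇒Prefix (chain n) (chain n') (⊒ʳ-just t) with refl ← leftChain-⊒⁻ n n' t = refl ∷ []
    ⊒ʳ⇒Prefix (spine {ss = ss} p) (spine {ss = ss'} p') (⊒ʳ-just t)
      with ms ← leftSpine-⊒⁻ ss ss' t
      with refl ← spine-arity-unique p p' ms = refl ∷ Pointwise-⊒ʳ⇒Prefix p p' ms

    -- A full piece of v lying inside the corresponding piece of u equals it, as leaves have no
    -- proper extensions; so v can only continue where u does.
    Pointwise-⊒ʳ⇒Prefix : ∀ {ls w v ss ss' f f'} → Encs ls w ss f → Encs ls v ss' f' →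
                          Pointwise _⊒ʳ_ ss ss' → Prefix _≡_ v w
    Pointwise-⊒ʳ⇒Prefix _ []-empty _ = []
    Pointwise-⊒ʳ⇒Prefix _ []-full _ = []
    Pointwise-⊒ʳ⇒Prefix _ (absent∷ _) _ = []
    Pointwise-⊒ʳ⇒Prefix (absent∷ _) (partial∷ e' _) (⊒ʳ-cut ∷ _) with () ← proj₂ (Enc-nothing e')
    Pointwise-⊒ʳ⇒Prefix (absent∷ _) (full∷ e' _) (⊒ʳ-cut ∷ _) with () ← proj₂ (Enc-nothing e')
    Pointwise-⊒ʳ⇒Prefix (partial∷ e p) (partial∷ e' p') (m ∷ ms) = ⊒ʳ⇒Prefix e e' m
    Pointwise-⊒ʳ⇒Prefix (full∷ {w = w} e p) (partial∷ e' p') (m ∷ ms) = ⊒ʳ⇒Prefix e e' m ++ᵖ w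
    Pointwise-⊒ʳ⇒Prefix {l ∷ ls} (partial∷ {c = c} e p) (full∷ {w = v} e' p') (m ∷ ms)
      with refl ← Leaf-Prefix-Node (Enc⇒Leaf e' refl) (Enc⇒Node e) (⊒ʳ⇒Prefix e e' m)
      with refl ← absents-⊒ʳ (subst (λ ss → Pointwise _⊒ʳ_ ss _) (Encs-[] p refl) ms)
      with refl ← Encs-absents p' = subst (λ x → Prefix _≡_ x c) (sym (++-identityʳ c)) Prefix-refl
    Pointwise-⊒ʳ⇒Prefix (full∷ {c = c} e p) (full∷ e' p') (m ∷ ms)
      with refl ← Leaf-Prefix-Node (Enc⇒Leaf e' refl) (Enc⇒Node e) (⊒ʳ⇒Prefix e e' m)
      = Prefix-++ˡ c (Pointwise-⊒ʳ⇒Prefix p p' ms)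

  Enc-injective : ∀ {l u v s f f'} → Enc l u s f → Enc l v s f' → u ≡ v
  Enc-injective {s = s} e e' = Prefix-antisym (⊒ʳ⇒Prefix e' e (⊒ʳ-refl s)) (⊒ʳ⇒Prefix e e' (⊒ʳ-refl s))

record FiniteAutomaton (Γ : Set) : Set₁ where
  field
    State     : Set
    Step      : Γ → Maybe State → Maybe State → State → Set
    step?     : ∀ x ql qr q → Dec (Step x ql qr q)
    accepting : State → Bool
    states    : List State
    step-∈    : ∀ {x ql qr q} → Step x ql qr q → q ∈ states

module _ {Γ : Set} (A : FiniteAutomaton Γ) where
  open FiniteAutomaton A

  mutual
    data Runs : Tree Γ → State → Set where
      run : ∀ {x l r ql qr q} → RunsM l ql → RunsM r qr → Step x ql qr q → Runs (node x l r) q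

    data RunsM : Maybe (Tree Γ) → Maybe State → Set where
      nothing : RunsM nothing nothing
      just    : ∀ {t q} → Runs t q → RunsM (just t) (just q)

  toTreeAutomaton : TreeAutomaton Γ
  toTreeAutomaton = record
    { nStates = length states
    ; δ       = λ x ql qr q →
                  does (step? x (Maybe.map (lookup states) ql) (Maybe.map (lookup states) qr) (lookup states q))
    ; final   = λ q → accepting (lookup states q)
    }

  private
    dec-true⁻ : ∀ {P : Set} (d : Dec P) → does d ≡ true → P
    dec-true⁻ (yes p) _ = p

    mutual
      Run⇒Runs : ∀ {t q} → Run toTreeAutomaton t q → Runs t (lookup states q)
      Run⇒Runs (run x l r ql qr q pl pr δ≡true) =
        run (RunM⇒RunsM pl) (RunM⇒RunsM pr) (dec-true⁻ (step? _ _ _ _) δ≡true)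

      RunM⇒RunsM : ∀ {m mq} → RunM toTreeAutomaton m mq → RunsM m (Maybe.map (lookup states) mq)
      RunM⇒RunsM none = nothing
      RunM⇒RunsM (some p) = just (Run⇒Runs p)

    mutual
      Runs⇒Run : ∀ {t q} → Runs t q → ∃[ j ] (lookup states j ≡ q × Run toTreeAutomaton t j)
      Runs⇒Run (run {x} {l} {r} pl pr st)
        with RunsM⇒RunM pl | RunsM⇒RunM pr | step-∈ st
      ... | jl , refl , rl | jr , refl , rr | q∈ rewrite lookup-index q∈ =
        index q∈ , refl , run x l r jl jr (index q∈) rl rr (dec-true (step? _ _ _ _) st)

      RunsM⇒RunM : ∀ {m mq} → RunsM m mq →
                   ∃[ mj ] (Maybe.map (lookup states) mj ≡ mq × RunM toTreeAutomaton m mj)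
      RunsM⇒RunM nothing = nothing , refl , none
      RunsM⇒RunM (just p) with Runs⇒Run p
      ... | j , refl , r = just j , refl , some r

  Accepted : Tree Γ → Set
  Accepted t = ∃[ q ] (Runs t q × accepting q ≡ true)

  Regular-Accepted : Regular Accepted
  Regular-Accepted = toTreeAutomaton , λ t → mk⇔ (to t) (from t)
    where
    to : ∀ t → Accepted t → Accepts toTreeAutomaton t
    to t (q , r , acc) with Runs⇒Run r
    ... | j , refl , r' = j , r' , acc

    from : ∀ t → Accepts toTreeAutomaton t → Accepted t
    from t (j , r , acc) = lookup states j , Run⇒Runs r , acc

Regular-⇔ : ∀ {Γ} {P Q : Tree Γ → Set} → (∀ t → P t ⇔ Q t) → Regular P → Regular Q
Regular-⇔ P⇔Q (B , P⇔B) = B , λ t → ⇔.trans (⇔.sym (P⇔Q t)) (P⇔B t)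

-- spineRoot L f labels the root of a spine read by a summand ω^(L+1) with status f; spineTail L f
-- a node below it, the right subtrees from there down encoding pieces read by ω^L.
data LevelState : Set where
  chain root : LevelState
  spineRoot spineTail : ℕ → Fill → LevelState

data Slot : ℕ → Maybe LevelState → Fill → Set where
  slot-absent : ∀ {l} → Slot l nothing empty
  slot-chain  : Slot 0 (just chain) full
  slot-spine  : ∀ {L f} → Slot (suc L) (just (spineRoot L f)) f

_≟ᶠ_ : (f f' : Fill) → Dec (f ≡ f')
empty ≟ᶠ empty = yes refl
partial ≟ᶠ partial = yes refl
full ≟ᶠ full = yes refl
empty ≟ᶠ partial = no λ ()
empty ≟ᶠ full = no λ ()
partial ≟ᶠ empty = no λ ()
partial ≟ᶠ full = no λ ()
full ≟ᶠ empty = no λ ()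
full ≟ᶠ partial = no λ ()

∃-Fill? : ∀ {Q : Fill → Set} → (∀ f → Dec (Q f)) → Dec (∃[ f ] Q f)
∃-Fill? Q? with Q? empty | Q? partial | Q? full
... | yes q | _ | _ = yes (empty , q)
... | no _ | yes q | _ = yes (partial , q)
... | no _ | no _ | yes q = yes (full , q)
... | no ¬e | no ¬p | no ¬f = no λ { (empty , q) → ¬e q ; (partial , q) → ¬p q ; (full , q) → ¬f q }

Slot? : ∀ l mq f → Dec (Slot l mq f)
Slot? l nothing empty = yes slot-absent
Slot? l nothing partial = no λ ()
Slot? l nothing full = no λ ()
Slot? zero (just chain) full = yes slot-chain
Slot? zero (just chain) empty = no λ ()
Slot? zero (just chain) partial = no λ ()
Slot? (suc l) (just chain) f = no λ ()
Slot? l (just root) f = no λ ()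
Slot? l (just (spineTail _ _)) f = no λ ()
Slot? zero (just (spineRoot L f')) f = no λ ()
Slot? (suc l) (just (spineRoot L f')) f with l ≟ L | f' ≟ᶠ f
... | yes refl | yes refl = yes slot-spine
... | no l≢L | _ = no λ { slot-spine → l≢L refl }
... | _ | no f'≢f = no λ { slot-spine → f'≢f refl }

Cons? : ∀ f₀ f₁ f → Dec (Cons f₀ f₁ f)
Cons? empty empty empty = yes empty-empty
Cons? partial empty partial = yes partial-empty
Cons? full f₁ f with f ≟ᶠ nonempty f₁
... | yes refl = yes full-any
... | no f≢ = no λ { full-any → f≢ refl }
Cons? empty empty partial = no λ ()
Cons? empty empty full = no λ ()
Cons? empty partial f = no λ ()
Cons? empty full f = no λ ()
Cons? partial empty empty = no λ ()
Cons? partial empty full = no λ ()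
Cons? partial partial f = no λ ()
Cons? partial full f = no λ ()

Ends? : ∀ f → Dec (Ends f)
Ends? empty = yes ends-empty
Ends? partial = no λ ()
Ends? full = yes ends-full

module LevelAutomaton (i : ℕ) where

  data Step : Maybe LevelState → Maybe LevelState → LevelState → Set where
    chain-end  : Step nothing nothing chain
    chain-step : Step (just chain) nothing chain
    at-root    : ∀ {mr f} → Slot i mr f → Step nothing mr root
    tail-end   : ∀ {L mr f₀ f₁ f} → L < i → Ends f₁ → Slot L mr f₀ → Cons f₀ f₁ f →
                 Step nothing mr (spineTail L f)
    tail-step  : ∀ {L mr f₀ f₁ f} → L < i → Slot L mr f₀ → Cons f₀ f₁ f →
                 Step (just (spineTail L f₁)) mr (spineTail L f)
    spine-root : ∀ {L mr f₀ f₁ f} → L < i → Slot 0 mr f₀ → Cons f₀ f₁ f →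
                 Step (just (spineTail L f₁)) mr (spineRoot L (nonempty f))

  accepting : LevelState → Bool
  accepting root = true
  accepting _ = false

  accepting⇒root : ∀ {q} → accepting q ≡ true → q ≡ root
  accepting⇒root {root} _ = refl

  fills : List Fill
  fills = empty ∷ partial ∷ full ∷ []

  fill-∈ : ∀ f → f ∈ fills
  fill-∈ empty = here refl
  fill-∈ partial = there (here refl)
  fill-∈ full = there (there (here refl))

  states : List LevelState
  states = chain ∷ root ∷ cartesianProductWith spineRoot (upTo i) fills
                      ++ cartesianProductWith spineTail (upTo i) fills

  spineRoot-∈ : ∀ {L f} → L < i → spineRoot L f ∈ states
  spineRoot-∈ L<i = there (there (∈-++⁺ˡ (∈-cartesianProductWith⁺ spineRoot (∈-upTo⁺ L<i) (fill-∈ _))))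

  spineTail-∈ : ∀ {L f} → L < i → spineTail L f ∈ states
  spineTail-∈ L<i = there (there (∈-++⁺ʳ _ (∈-cartesianProductWith⁺ spineTail (∈-upTo⁺ L<i) (fill-∈ _))))

  step-∈ : ∀ {ql qr q} → Step ql qr q → q ∈ states
  step-∈ chain-end = here refl
  step-∈ chain-step = here refl
  step-∈ (at-root _) = there (here refl)
  step-∈ (tail-end L<i _ _ _) = spineTail-∈ L<i
  step-∈ (tail-step L<i _ _) = spineTail-∈ L<i
  step-∈ (spine-root L<i _ _) = spineRoot-∈ L<i

  step? : ∀ ql qr q → Dec (Step ql qr q)
  step? nothing nothing chain = yes chain-end
  step? (just chain) nothing chain = yes chain-step
  step? nothing (just _) chain = no λ ()
  step? (just chain) (just _) chain = no λ ()
  step? (just root) _ chain = no λ ()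
  step? (just (spineRoot _ _)) _ chain = no λ ()
  step? (just (spineTail _ _)) _ chain = no λ ()
  step? nothing mr root with ∃-Fill? (Slot? i mr)
  ... | yes (_ , s) = yes (at-root s)
  ... | no ¬s = no λ { (at-root s) → ¬s (_ , s) }
  step? (just _) mr root = no λ ()
  step? nothing mr (spineTail L f)
    with L <? i | ∃-Fill? (λ f₁ → Ends? f₁ ×-dec ∃-Fill? (λ f₀ → Slot? L mr f₀ ×-dec Cons? f₀ f₁ f))
  ... | yes L<i | yes (_ , e , _ , s , c) = yes (tail-end L<i e s c)
  ... | no L≮i | _ = no λ { (tail-end L<i _ _ _) → L≮i L<i }
  ... | _ | no ¬p = no λ { (tail-end _ e s c) → ¬p (_ , e , _ , s , c) }
  step? (just (spineTail L' f₁)) mr (spineTail L f)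
    with L' ≟ L | L <? i | ∃-Fill? (λ f₀ → Slot? L mr f₀ ×-dec Cons? f₀ f₁ f)
  ... | yes refl | yes L<i | yes (_ , s , c) = yes (tail-step L<i s c)
  ... | no L'≢L | _ | _ = no λ { (tail-step _ _ _) → L'≢L refl }
  ... | yes refl | no L≮i | _ = no λ { (tail-step L<i _ _) → L≮i L<i }
  ... | yes refl | yes _ | no ¬p = no λ { (tail-step _ s c) → ¬p (_ , s , c) }
  step? (just chain) mr (spineTail L f) = no λ ()
  step? (just root) mr (spineTail L f) = no λ ()
  step? (just (spineRoot _ _)) mr (spineTail L f) = no λ ()
  step? (just (spineTail L' f₁)) mr (spineRoot L f)
    with L' ≟ L | L <? i
       | ∃-Fill? (λ f' → (f ≟ᶠ nonempty f') ×-dec ∃-Fill? (λ f₀ → Slot? 0 mr f₀ ×-dec Cons? f₀ f₁ f'))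
  ... | yes refl | yes L<i | yes (_ , refl , _ , s , c) = yes (spine-root L<i s c)
  ... | no L'≢L | _ | _ = no λ { (spine-root _ _ _) → L'≢L refl }
  ... | yes refl | no L≮i | _ = no λ { (spine-root L<i _ _) → L≮i L<i }
  ... | yes refl | yes _ | no ¬p = no λ { (spine-root _ s c) → ¬p (_ , refl , _ , s , c) }
  step? nothing mr (spineRoot L f) = no λ ()
  step? (just chain) mr (spineRoot L f) = no λ ()
  step? (just root) mr (spineRoot L f) = no λ ()
  step? (just (spineRoot _ _)) mr (spineRoot L f) = no λ ()

  automaton : (Lab : Set) → FiniteAutomaton Lab
  automaton Lab = record
    { State = LevelState ; Step = λ _ → Step ; step? = λ _ → step? ; accepting = accepting
    ; states = states ; step-∈ = step-∈ }

module LevelAutomatonCorrect (i : ℕ) {Lab : Set} (a : Lab) (a-unique : ∀ x → x ≡ a) where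
  open Encoding a
  open LevelAutomaton i

  A : FiniteAutomaton Lab
  A = automaton Lab

  mutual
    Runs-chain : ∀ {t} → Runs A t chain → ∃[ n ] t ≡ leftChain n
    Runs-chain (run {x} nothing nothing chain-end) rewrite a-unique x = 0 , refl
    Runs-chain (run {x} (just p) nothing chain-step) with Runs-chain p
    ... | n , refl rewrite a-unique x = suc n , refl

    Runs-spineTail : ∀ {t L f} → Runs A t (spineTail L f) →
      ∃[ h ] ∃[ ss ] ∃[ w ] (t ≡ leftSpine h ss × Encs (replicate (suc (length ss)) L) w (h ∷ ss) f)
    Runs-spineTail (run {x} {r = h} nothing pr (tail-end _ ends sl c))
      with _ , e ← RunsM-Slot pr sl
      with _ , p ← Encs-cons e (Ends⇒Encs-[] ends) c
      rewrite a-unique x = h , [] , _ , refl , p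
    Runs-spineTail (run {x} {r = h} (just q) pr (tail-step _ sl c))
      with h' , ss , _ , refl , p ← Runs-spineTail q
      with _ , e ← RunsM-Slot pr sl
      with _ , p' ← Encs-cons e p c
      rewrite a-unique x = h , h' ∷ ss , _ , refl , p'

    Runs-spineRoot : ∀ {t L f} → Runs A t (spineRoot L f) → ∃[ w ] Enc (suc L) w (just t) f
    Runs-spineRoot (run {x} (just q) pr (spine-root _ sl c))
      with h , ss , _ , refl , p ← Runs-spineTail q
      with _ , e ← RunsM-Slot pr sl
      with _ , p' ← Encs-cons e p c
      rewrite a-unique x = _ , spine p'

    RunsM-Slot : ∀ {m mq l f} → RunsM A m mq → Slot l mq f → ∃[ w ] Enc l w m f
    RunsM-Slot nothing slot-absent = [] , absent
    RunsM-Slot (just q) slot-chain with n , refl ← Runs-chain q = _ , chain n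
    RunsM-Slot (just q) slot-spine = Runs-spineRoot q

  Runs-root : ∀ {t} → Runs A t root → ∃[ w ] ∃[ m ] ∃[ f ] (Enc i w m f × t ≡ node a nothing m)
  Runs-root (run {x} {r = m} nothing pr (at-root sl)) with w , e ← RunsM-Slot pr sl rewrite a-unique x =
    w , m , _ , e , refl

  leftChain-Runs : ∀ n → Runs A (leftChain n) chain
  leftChain-Runs zero = run nothing nothing chain-end
  leftChain-Runs (suc n) = run (just (leftChain-Runs n)) nothing chain-step

  SlotRun : ℕ → Maybe (Tree Lab) → Fill → Set
  SlotRun l m f = ∃[ mq ] (RunsM A m mq × Slot l mq f)

  mutual
    Enc-SlotRun : ∀ {l w m f} → Enc l w m f → l ≤ i → SlotRun l m f
    Enc-SlotRun absent _ = nothing , nothing , slot-absent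
    Enc-SlotRun (chain n) _ = just chain , just (leftChain-Runs n) , slot-chain
    Enc-SlotRun (spine p) L<i = _ , just (Encs-spineRoot p L<i) , slot-spine

    Encs-uncons : ∀ {l ls w m ss f} → Encs (l ∷ ls) w (m ∷ ss) f → l ≤ i →
                  ∃[ f₀ ] ∃[ f₁ ] ∃[ w' ] (SlotRun l m f₀ × Encs ls w' ss f₁ × Cons f₀ f₁ f)
    Encs-uncons (absent∷ p) _ = _ , _ , _ , (nothing , nothing , slot-absent) , p , empty-empty
    Encs-uncons (partial∷ e p) l≤i = _ , _ , _ , Enc-SlotRun e l≤i , p , partial-empty
    Encs-uncons (full∷ e p) l≤i = _ , _ , _ , Enc-SlotRun e l≤i , p , full-any

    Encs-spineTail : ∀ {k L w h ss f} → Encs (replicate (suc k) L) w (h ∷ ss) f → L < i →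
                     Runs A (leftSpine h ss) (spineTail L f)
    Encs-spineTail {zero} {ss = []} p L<i with _ , _ , _ , (_ , rs , sl) , p' , c ← Encs-uncons p (<⇒≤ L<i) =
      run nothing rs (tail-end L<i (Encs-[]-Ends p') sl c)
    Encs-spineTail {suc k} {ss = _ ∷ _} p L<i with _ , _ , _ , (_ , rs , sl) , p' , c ← Encs-uncons p (<⇒≤ L<i) =
      run (just (Encs-spineTail p' L<i)) rs (tail-step L<i sl c)
    Encs-spineTail {zero} {ss = _ ∷ _} p _ with () ← Encs-length p
    Encs-spineTail {suc k} {ss = []} p _ with () ← Encs-length p

    Encs-spineRoot : ∀ {k L w h ss f} → Encs (0 ∷ replicate (suc k) L) w (h ∷ ss) f → suc L ≤ i →
                     Runs A (leftSpine h ss) (spineRoot L (nonempty f))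
    Encs-spineRoot {ss = _ ∷ _} p L<i with _ , _ , _ , (_ , rs , sl) , p' , c ← Encs-uncons p z≤n =
      run (just (Encs-spineTail p' L<i)) rs (spine-root L<i sl c)
    Encs-spineRoot {ss = []} p _ with () ← Encs-length p

  Enc-root : ∀ {w m f} → Enc i w m f → Runs A (node a nothing m) root
  Enc-root e with _ , rs , sl ← Enc-SlotRun e ≤-refl = run nothing rs (at-root sl)

-- A synchronous run on conv t t' : both components run A where both trees are present, and only
-- the first where t' has been pruned.
module PruningAutomaton {Lab : Set} (A : FiniteAutomaton Lab) where
  open FiniteAutomaton A

  Pair : Set
  Pair = State × Maybe State

  fstM : Maybe Pair → Maybe State
  fstM nothing = nothing
  fstM (just (q , _)) = just q

  sndM : Maybe Pair → Maybe State
  sndM nothing = nothing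
  sndM (just (_ , mq')) = mq'

  data Aligned : Maybe Pair → Set where
    nothing : Aligned nothing
    just    : ∀ {q q'} → Aligned (just (q , just q'))

  data FirstOnly : Maybe Pair → Set where
    nothing : FirstOnly nothing
    just    : ∀ {q} → FirstOnly (just (q , nothing))

  Aligned? : ∀ m → Dec (Aligned m)
  Aligned? nothing = yes nothing
  Aligned? (just (_ , just _)) = yes just
  Aligned? (just (_ , nothing)) = no λ ()

  FirstOnly? : ∀ m → Dec (FirstOnly m)
  FirstOnly? nothing = yes nothing
  FirstOnly? (just (_ , nothing)) = yes just
  FirstOnly? (just (_ , just _)) = no λ ()

  data Step₂ : Maybe Lab × Maybe Lab → Maybe Pair → Maybe Pair → Pair → Set where
    both  : ∀ {x y ql qr q q'} → Step x (fstM ql) (fstM qr) q → Step y (sndM ql) (sndM qr) q' → Aligned ql →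
            Step₂ (just x , just y) ql qr (q , just q')
    first : ∀ {x ql qr q} → Step x (fstM ql) (fstM qr) q → FirstOnly ql → FirstOnly qr →
            Step₂ (just x , nothing) ql qr (q , nothing)

  step₂? : ∀ xy ql qr q → Dec (Step₂ xy ql qr q)
  step₂? (just x , just y) ql qr (q , just q')
    with step? x (fstM ql) (fstM qr) q ×-dec step? y (sndM ql) (sndM qr) q' ×-dec Aligned? ql
  ... | yes (s , s' , al) = yes (both s s' al)
  ... | no ¬p = no λ { (both s s' al) → ¬p (s , s' , al) }
  step₂? (just x , just y) ql qr (q , nothing) = no λ ()
  step₂? (just x , nothing) ql qr (q , nothing)
    with step? x (fstM ql) (fstM qr) q ×-dec FirstOnly? ql ×-dec FirstOnly? qr
  ... | yes (s , fl , fr) = yes (first s fl fr)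
  ... | no ¬p = no λ { (first s fl fr) → ¬p (s , fl , fr) }
  step₂? (just x , nothing) ql qr (q , just _) = no λ ()
  step₂? (nothing , _) ql qr q = no λ ()

  accepting₂ : Pair → Bool
  accepting₂ (q , just q') = accepting q ∧ accepting q'
  accepting₂ (q , nothing) = false

  automaton₂ : FiniteAutomaton (Maybe Lab × Maybe Lab)
  automaton₂ = record
    { State = Pair ; Step = Step₂ ; step? = step₂? ; accepting = accepting₂
    ; states = cartesianProduct states (nothing ∷ List.map just states)
    ; step-∈ = λ where
        (both s s' _) → ∈-cartesianProduct⁺ (step-∈ s) (there (∈-map⁺ just (step-∈ s')))
        (first s _ _) → ∈-cartesianProduct⁺ (step-∈ s) (here refl)
    }

  private
    ∧-≡true : ∀ {x y} → x ∧ y ≡ true → x ≡ true × y ≡ true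
    ∧-≡true {true} {true} _ = refl , refl

  convˡ : Tree Lab → Tree (Maybe Lab × Maybe Lab)
  convˡ (node x l r) = node (just x , nothing) (convM l nothing) (convM r nothing)

  convM-just-nothing : ∀ t → convM (just t) nothing ≡ just (convˡ t)
  convM-just-nothing (node x l r) = refl

  convM-just-just : ∀ (t t' : Tree Lab) → convM (just t) (just t') ≡ just (conv t t')
  convM-just-just (node x l r) (node y l' r') = refl

  firstOnly : Maybe State → Maybe Pair
  firstOnly nothing = nothing
  firstOnly (just q) = just (q , nothing)

  fstM-firstOnly : ∀ mq → fstM (firstOnly mq) ≡ mq
  fstM-firstOnly nothing = refl
  fstM-firstOnly (just q) = refl

  FirstOnly-firstOnly : ∀ mq → FirstOnly (firstOnly mq)
  FirstOnly-firstOnly nothing = nothing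
  FirstOnly-firstOnly (just q) = just

  mutual
    Runs-first : ∀ {t q} → Runs A t q → Runs automaton₂ (convˡ t) (q , nothing)
    Runs-first (run {x} {ql = ql} {qr} {q} pl pr s) =
      run (RunsM-first pl) (RunsM-first pr)
          (first (subst₂ (λ ml mr → Step x ml mr q) (sym (fstM-firstOnly ql)) (sym (fstM-firstOnly qr)) s)
                 (FirstOnly-firstOnly ql) (FirstOnly-firstOnly qr))

    RunsM-first : ∀ {m mq} → RunsM A m mq → RunsM automaton₂ (convM m nothing) (firstOnly mq)
    RunsM-first nothing = nothing
    RunsM-first (just p@(run _ _ _)) = just (Runs-first p)

  record ChildRun (m m' : Maybe (Tree Lab)) (mq mq' : Maybe State) : Set where
    constructor childRun
    field
      pair  : Maybe Pair
      runs  : RunsM automaton₂ (convM m m') pair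
      fst≡  : fstM pair ≡ mq
      snd≡  : sndM pair ≡ mq'

  mutual
    Runs-both : ∀ {t t' q q'} → Runs A t q → Runs A t' q' → t ⊒ t' → Runs automaton₂ (conv t t') (q , just q')
    Runs-both (run {x} {q = q} pl pr s) (run {y} {q = q'} pl' pr' s') (⊒-node ml mr)
      with ChildRun-left pl pl' ml | ChildRun-right pr pr' mr
    ... | childRun _ rl refl refl , al | childRun _ rr refl refl = run rl rr (both s s' al)

    ChildRun-left : ∀ {m m' mq mq'} → RunsM A m mq → RunsM A m' mq' → m ⊒ˡ m' →
                    Σ (ChildRun m m' mq mq') (Aligned ∘ ChildRun.pair)
    ChildRun-left nothing nothing ⊒ˡ-nothing = childRun nothing nothing refl refl , nothing
    ChildRun-left (just p@(run _ _ _)) (just p'@(run _ _ _)) (⊒ˡ-just t) =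
      childRun _ (just (Runs-both p p' t)) refl refl , just

    ChildRun-right : ∀ {m m' mq mq'} → RunsM A m mq → RunsM A m' mq' → m ⊒ʳ m' → ChildRun m m' mq mq'
    ChildRun-right nothing nothing ⊒ʳ-cut = childRun nothing nothing refl refl
    ChildRun-right (just p@(run _ _ _)) nothing ⊒ʳ-cut = childRun _ (just (Runs-first p)) refl refl
    ChildRun-right (just p@(run _ _ _)) (just p'@(run _ _ _)) (⊒ʳ-just t) =
      childRun _ (just (Runs-both p p' t)) refl refl

  mutual
    Runs-first⁻ : ∀ {x q} → Runs automaton₂ x (q , nothing) → ∃[ t ] (x ≡ convˡ t × Runs A t q)
    Runs-first⁻ (run pl pr (first {x = y} s fl fr))
      with ml , refl , rl ← RunsM-first⁻ pl fl | mr , refl , rr ← RunsM-first⁻ pr fr =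
      node y ml mr , refl , run rl rr s

    RunsM-first⁻ : ∀ {m mp} → RunsM automaton₂ m mp → FirstOnly mp →
                   ∃[ mt ] (m ≡ convM mt nothing × RunsM A mt (fstM mp))
    RunsM-first⁻ nothing nothing = nothing , refl , nothing
    RunsM-first⁻ (just p) just with t , refl , r ← Runs-first⁻ p = just t , sym (convM-just-nothing t) , just r

  mutual
    Runs-both⁻ : ∀ {x q q'} → Runs automaton₂ x (q , just q') →
                 ∃[ t ] ∃[ t' ] (x ≡ conv t t' × Runs A t q × Runs A t' q' × t ⊒ t')
    Runs-both⁻ (run pl pr (both {x = y} {y = y'} s s' al))
      with ml , ml' , refl , rl , rl' , ⊒l ← RunsM-left⁻ pl al
         | mr , mr' , refl , rr , rr' , ⊒r ← RunsM-right⁻ pr =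
      node y ml mr , node y' ml' mr' , refl , run rl rr s , run rl' rr' s' , ⊒-node ⊒l ⊒r

    RunsM-left⁻ : ∀ {m mp} → RunsM automaton₂ m mp → Aligned mp →
      ∃[ mt ] ∃[ mt' ] (m ≡ convM mt mt' × RunsM A mt (fstM mp) × RunsM A mt' (sndM mp) × mt ⊒ˡ mt')
    RunsM-left⁻ nothing nothing = nothing , nothing , refl , nothing , nothing , ⊒ˡ-nothing
    RunsM-left⁻ (just p) just with t , t' , refl , r , r' , ⊒t ← Runs-both⁻ p =
      just t , just t' , sym (convM-just-just t t') , just r , just r' , ⊒ˡ-just ⊒t

    RunsM-right⁻ : ∀ {m mp} → RunsM automaton₂ m mp →
      ∃[ mt ] ∃[ mt' ] (m ≡ convM mt mt' × RunsM A mt (fstM mp) × RunsM A mt' (sndM mp) × mt ⊒ʳ mt')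
    RunsM-right⁻ nothing = nothing , nothing , refl , nothing , nothing , ⊒ʳ-cut
    RunsM-right⁻ (just {q = _ , nothing} p) with t , refl , r ← Runs-first⁻ p =
      just t , nothing , sym (convM-just-nothing t) , just r , nothing , ⊒ʳ-cut
    RunsM-right⁻ (just {q = _ , just _} p) with t , t' , refl , r , r' , ⊒t ← Runs-both⁻ p =
      just t , just t' , sym (convM-just-just t t') , just r , just r' , ⊒ʳ-just ⊒t

  PrunedConv : Tree (Maybe Lab × Maybe Lab) → Set
  PrunedConv x = ∃[ t ] ∃[ t' ] (Accepted A t × Accepted A t' × t ⊒ t' × x ≡ conv t t')

  Regular-⊒ : Regular PrunedConv
  Regular-⊒ = Regular-⇔ (λ x → mk⇔ from to) (Regular-Accepted automaton₂)
    where
    to : ∀ {x} → PrunedConv x → Accepted automaton₂ x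
    to (t , t' , (q , r , acc) , (q' , r' , acc') , ⊒t , refl) =
      (q , just q') , Runs-both r r' ⊒t , cong₂ _∧_ acc acc'

    from : ∀ {x} → Accepted automaton₂ x → PrunedConv x
    from ((q , just q') , r , acc) with acc-q , acc-q' ← ∧-≡true {accepting q} acc
      with t , t' , eq , rt , rt' , ⊒t ← Runs-both⁻ r =
      t , t' , (q , rt , acc-q) , (q' , rt' , acc-q') , ⊒t , eq

module Copy (i : ℕ) {Lab : Set} (a : Lab) (a-unique : ∀ x → x ≡ a) where
  open Encoding a
  open LevelAutomaton i using (accepting⇒root)
  open LevelAutomatonCorrect i a a-unique
  open PruningAutomaton A using (Regular-⊒)

  -- The extra root keeps the encoding of the empty word, the root of 𝔖, a tree.
  encodeNode : List ℕ → Tree Lab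
  encodeNode u = node a nothing (proj₁ (encode i u))

  ∈𝔖⇒Enc : ∀ {u} → u ∈𝔖 ω^ i → ∃[ m ] ∃[ f ] (Enc i u m f × encodeNode u ≡ node a nothing m)
  ∈𝔖⇒Enc p with m , f , e ← Node⇒Enc i (Equivalence.to (∈𝔖ω^⇔Node i) p) =
    m , f , e , cong (λ r → node a nothing (proj₁ r)) (Enc⇒encode e)

  encodeNode-Accepted : ∀ u → u ∈𝔖 ω^ i → Accepted A (encodeNode u)
  encodeNode-Accepted u p with _ , _ , e , eq ← ∈𝔖⇒Enc p rewrite eq = LevelState.root , Enc-root e , refl

  encodeNode-injective : ∀ u v → u ∈𝔖 ω^ i → v ∈𝔖 ω^ i → encodeNode u ≡ encodeNode v → u ≡ v
  encodeNode-injective u v pu pv eq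
    with _ , _ , e , eu ← ∈𝔖⇒Enc pu | _ , _ , e' , ev ← ∈𝔖⇒Enc pv
    with refl ← trans (sym eu) (trans eq ev) = Enc-injective e e'

  encodeNode-surjective : ∀ t → Accepted A t → ∃[ u ] (u ∈𝔖 ω^ i × encodeNode u ≡ t)
  encodeNode-surjective t (q , r , acc) with refl ← accepting⇒root acc
    with w , m , f , e , refl ← Runs-root r =
    w , Equivalence.from (∈𝔖ω^⇔Node i) (Enc⇒Node e) , cong (λ r → node a nothing (proj₁ r)) (Enc⇒encode e)

  encodeNode-mono : ∀ u v → u ∈𝔖 ω^ i → v ∈𝔖 ω^ i → (u ≤𝔖 v ⇔ encodeNode u ⊒ encodeNode v)
  encodeNode-mono u v pu pv
    with m , _ , e , eu ← ∈𝔖⇒Enc pu | m' , _ , e' , ev ← ∈𝔖⇒Enc pv rewrite eu | ev = mk⇔ to from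
    where
    to : Prefix _≡_ v u → node a nothing m ⊒ node a nothing m'
    to pre with _ , _ , e″ , m⊒ ← Enc-Prefix e pre with refl ← Enc-functional e″ e' = ⊒-node ⊒ˡ-nothing m⊒

    from : node a nothing m ⊒ node a nothing m' → Prefix _≡_ v u
    from (⊒-node ⊒ˡ-nothing m⊒) = ⊒ʳ⇒Prefix e e' m⊒

  copy : TreeAutoCopy Lab (ω^ i)
  copy = record
    { L      = Accepted A
    ; _≤L_   = _⊒_
    ; L-reg  = Regular-Accepted A
    ; ≤-reg  = Regular-⊒
    ; f      = encodeNode
    ; f-into = encodeNode-Accepted
    ; f-inj  = encodeNode-injective
    ; f-onto = encodeNode-surjective
    ; f-mono = encodeNode-mono
    }

-- The construction works for every i.
lemma5p5 : ∀ (i : ℕ) → i ≥ 1 → TreeAutomatic (ω^ i) × UnaryTreeAutoCopy (ω^ i)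
lemma5p5 i _ = (1 , Copy.copy i {Fin 1} Fin.zero λ { Fin.zero → refl }) , Copy.copy i tt λ _ → refl
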